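{- Let $(C,e,\lambda_1,\oplus_1)$ be the free Catalan structure, let $(\lambda_i,\oplus_i)_{i\ge 1}$ be the sequence of operations on $C$ obtained by iterating the secondary structure construction, and let $M=h\circ\mathrm{rev}\colon C\to C$, with $h$ and $\mathrm{rev}$ defined from $(\lambda_1,\oplus_1)$. For every nonnegative integer $p$, $$(\lambda_{p+1},\oplus_{p+1})=(\lambda_1,\oplus_1)\quad\Longleftrightarrow\quad M^p=\operatorname{id}\text{ on }C.$$
   Context: A Catalan structure is a quadruple $(C,e,\lambda,\oplus)$ where $C=\bigsqcup_{n\ge 0}C_n$ with $C_0=\{e\}$ ($|t|=n$ for $t\in C_n$), $\lambda\colon C_n\to C_{n+1}$, $\oplus\colon C_m\times C_n\to C_{m+n}$, $\oplus$ is associative with two-sided identity $e$, and every $t\in C$ can be written uniquely in exactly one of three forms: $t=e$; $t=\lambda(s)$ with $s\in C$ (indecomposable); $t=u\oplus v$ with $u$ indecomposable and $v\in C\setminus C_0$ (decomposable). Hence every nonempty $t$ is uniquely $\lambda(u)\oplus v$ ($v=e$ allowed). The free Catalan structure is realized by the formal expressions $e$, $\lambda(t)$, $\lambda(u)\oplus v$ with $v\ne e$; it is isomorphic to rooted plane trees written as lists of children, with $e=[\,]$, $\lambda(T)=[T]$, $\oplus$ = concatenation of child lists. Secondary structure construction: from a Catalan structure $(C,e,\lambda_i,\oplus_i)$ define $\lambda_{i+1}(t)=t\oplus_i\lambda_i(e)$ and $\oplus_{i+1}$ recursively in the first argument by $e\oplus_{i+1}v=v$, $\lambda_i(u)\oplus_{i+1}v=\lambda_i(u\oplus_{i+1}v)$,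 $(t\oplus_i u)\oplus_{i+1}v=t\oplus_i(u\oplus_{i+1}v)$ for $t,u\neq e$. Then $(C,e,\lambda_{i+1},\oplus_{i+1})$ is again a Catalan structure, so the construction can be iterated. Write $\lambda=\lambda_1$, $\oplus=\oplus_1$, $\gamma=\lambda_2$, $\ominus=\oplus_2$. The maps: $h(e)=e$, $h(\lambda(u)\oplus v)=h(v)\ominus\gamma(h(u))$; $\mathrm{rev}(e)=e$, $\mathrm{rev}(\lambda(u)\oplus v)=\mathrm{rev}(v)\oplus\lambda(\mathrm{rev}(u))$. Both are size-preserving involutions of $C$. -}

module Defs where

open import Algebra.Structures using (IsMonoid)
open import Data.Empty using (⊥-elim)
open import Data.List.Base using (List; []; _∷_; [_]; _++_)
open import Data.List.Properties using (++-assoc; ++-identityʳ; ∷-injective)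
open import Data.Nat.Base using (ℕ; suc; _+_; _<_; s≤s; NonZero)
open import Data.Nat.GeneralisedArithmetic using (fold)
open import Data.Nat.Induction using (<-wellFounded)
open import Data.Nat.Properties
  using (+-assoc; +-identityʳ; +-suc; +-comm; ≤-refl; m≤n+m; m+n≡0⇒m≡0; m+n≡0⇒n≡0)
open import Data.Product.Base using (_×_; _,_; ∃-syntax; proj₁; proj₂)
open import Data.Sum.Base using (_⊎_; inj₁; inj₂)
open import Function.Base using (_∘_)
open import Induction.WellFounded using (Acc; acc)
open import Relation.Binary.PropositionalEquality hiding ([_])

-- The grading C = ⨆ Cₙ is given by the size function ∣_∣ on C, so that
-- Cₙ = { t ∣ ∣ t ∣ ≡ n }.  The operation written λ on paper is Λ here.

Indecomposable : {C : Set} (Λ : C → C) → C → Set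
Indecomposable Λ t = ∃[ s ] t ≡ Λ s

data Form {C : Set} (e : C) (Λ : C → C) (_⊕_ : C → C → C) (t : C) : Set where
  empty  : t ≡ e → Form e Λ _⊕_ t
  indec  : Indecomposable Λ t → Form e Λ _⊕_ t
  decomp : ∀ u v → Indecomposable Λ u → v ≢ e → t ≡ u ⊕ v → Form e Λ _⊕_ t

record IsCatalan {C : Set} (∣_∣ : C → ℕ) (e : C)
                 (Λ : C → C) (_⊕_ : C → C → C) : Set where
  private
    Indec : C → Set
    Indec = Indecomposable Λ
  field
    ∣e∣         : ∣ e ∣ ≡ 0
    ∣t∣≡0⇒t≡e   : ∀ {t} → ∣ t ∣ ≡ 0 → t ≡ e
    ∣Λ∣         : ∀ t → ∣ Λ t ∣ ≡ suc ∣ t ∣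
    ∣⊕∣         : ∀ u v → ∣ u ⊕ v ∣ ≡ ∣ u ∣ + ∣ v ∣
    ⊕-isMonoid  : IsMonoid _≡_ _⊕_ e

    -- Every element has one of the three forms, ...
    form        : ∀ t → Form e Λ _⊕_ t
    -- ... the forms exclude each other, ...
    Λ≢e         : ∀ {s} → Λ s ≢ e
    ⊕≢e         : ∀ {u v} → Indec u → v ≢ e → u ⊕ v ≢ e
    Λ≢⊕         : ∀ {s u v} → Indec u → v ≢ e → Λ s ≢ u ⊕ v
    -- ... and each form is attained in only one way.
    Λ-injective : ∀ {s t} → Λ s ≡ Λ t → s ≡ t
    ⊕-unique    : ∀ {u v u′ v′} → Indec u → v ≢ e → Indec u′ → v′ ≢ e →
                  u ⊕ v ≡ u′ ⊕ v′ → u ≡ u′ × v ≡ v′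

-- C, its grading and e are fixed parameters, because the secondary
-- construction changes only the two operations.

record Catalan {C : Set} (∣_∣ : C → ℕ) (e : C) : Set where
  infixr 5 _⊕_
  field
    Λ         : C → C
    _⊕_       : C → C → C
    isCatalan : IsCatalan ∣_∣ e Λ _⊕_
  open IsCatalan isCatalan public

infix 4 _≈_

_≈_ : {C : Set} {∣_∣ : C → ℕ} {e : C} → Catalan ∣_∣ e → Catalan ∣_∣ e → Set
S ≈ T = (∀ t → S.Λ t ≡ T.Λ t) × (∀ u v → u S.⊕ v ≡ u T.⊕ v)
  where
  module S = Catalan S
  module T = Catalan T

module Secondary {C : Set} {∣_∣ : C → ℕ} {e : C} (S : Catalan ∣_∣ e) where
  open Catalan S

  open IsMonoid ⊕-isMonoid using ()
    renaming (assoc to ⊕-assoc; identityˡ to ⊕-identityˡ; identityʳ to ⊕-identityʳ)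

  -- View t is the tree of choices made when the unique decomposition of t is
  -- applied recursively; ⊖ is defined by recursion on it.

  data View (t : C) : Set where
    v-e : t ≡ e → View t
    v-Λ : ∀ s → t ≡ Λ s → View s → View t
    v-⊕ : ∀ s w → w ≢ e → t ≡ Λ s ⊕ w → View s → View w → View t

  private
    s<Λs : ∀ {t s} → t ≡ Λ s → ∣ s ∣ < ∣ t ∣
    s<Λs {s = s} refl rewrite ∣Λ∣ s = ≤-refl

    s<Λs⊕w : ∀ {t s w} → t ≡ Λ s ⊕ w → ∣ s ∣ < ∣ t ∣
    s<Λs⊕w {s = s} {w} refl
      rewrite ∣⊕∣ (Λ s) w | ∣Λ∣ s | +-comm ∣ s ∣ ∣ w ∣ = s≤s (m≤n+m _ _)

    w<Λs⊕w : ∀ {t s w} → t ≡ Λ s ⊕ w → ∣ w ∣ < ∣ t ∣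
    w<Λs⊕w {s = s} {w} refl rewrite ∣⊕∣ (Λ s) w | ∣Λ∣ s = s≤s (m≤n+m _ _)

    view-acc : ∀ t → Acc _<_ ∣ t ∣ → View t
    view-acc t (acc rs) with form t
    ... | empty t≡e = v-e t≡e
    ... | indec (s , eq) = v-Λ s eq (view-acc s (rs (s<Λs eq)))
    ... | decomp _ w (s , refl) w≢e eq =
          v-⊕ s w w≢e eq (view-acc s (rs (s<Λs⊕w eq))) (view-acc w (rs (w<Λs⊕w eq)))

  view : ∀ t → View t
  view t = view-acc t (<-wellFounded ∣ t ∣)

  infixr 5 _⊖_

  γ : C → C
  γ t = t ⊕ Λ e

  mul : ∀ {t} → View t → C → C
  mul (v-e _)           v = v
  mul (v-Λ _ _ p)       v = Λ (mul p v)
  mul (v-⊕ s _ _ _ _ p) v = Λ s ⊕ mul p v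

  _⊖_ : C → C → C
  t ⊖ v = mul (view t) v

  private
    mul-irr : ∀ {t t′} (p : View t) (q : View t′) v → t ≡ t′ → mul p v ≡ mul q v
    mul-irr (v-e _) (v-e _) v _ = refl
    mul-irr (v-e a) (v-Λ _ b _) v eq = ⊥-elim (Λ≢e (trans (sym b) (trans (sym eq) a)))
    mul-irr (v-e a) (v-⊕ s w w≢e b _ _) v eq =
      ⊥-elim (⊕≢e (s , refl) w≢e (trans (sym b) (trans (sym eq) a)))
    mul-irr (v-Λ _ a _) (v-e b) v eq = ⊥-elim (Λ≢e (trans (sym a) (trans eq b)))
    mul-irr (v-Λ _ a p) (v-Λ _ b q) v eq =
      cong Λ (mul-irr p q v (Λ-injective (trans (sym a) (trans eq b))))
    mul-irr (v-Λ _ a _) (v-⊕ s w w≢e b _ _) v eq =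
      ⊥-elim (Λ≢⊕ (s , refl) w≢e (trans (sym a) (trans eq b)))
    mul-irr (v-⊕ s w w≢e a _ _) (v-e b) v eq =
      ⊥-elim (⊕≢e (s , refl) w≢e (trans (sym a) (trans eq b)))
    mul-irr (v-⊕ s w w≢e a _ _) (v-Λ _ b _) v eq =
      ⊥-elim (Λ≢⊕ (s , refl) w≢e (trans (sym b) (trans (sym eq) a)))
    mul-irr (v-⊕ s w w≢e a _ p) (v-⊕ s′ w′ w′≢e b _ q) v eq
      with ⊕-unique (s , refl) w≢e (s′ , refl) w′≢e (trans (sym a) (trans eq b))
    ... | Λs≡Λs′ , w≡w′ = cong₂ _⊕_ Λs≡Λs′ (mul-irr p q v w≡w′)

  induction : (P : C → Set) → P e → (∀ s → P s → P (Λ s)) →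
              (∀ s w → w ≢ e → P s → P w → P (Λ s ⊕ w)) → ∀ t → P t
  induction P pe pΛ p⊕ t = go (view t)
    where
    go : ∀ {t} → View t → P t
    go (v-e refl)             = pe
    go (v-Λ s refl p)         = pΛ s (go p)
    go (v-⊕ s w w≢e refl p q) = p⊕ s w w≢e (go p) (go q)

  private
    ≢eˡ : ∀ {u v} → u ≢ e → u ⊕ v ≢ e
    ≢eˡ {u} {v} u≢e eq =
      u≢e (∣t∣≡0⇒t≡e (m+n≡0⇒m≡0 ∣ u ∣ (trans (sym (∣⊕∣ u v)) (trans (cong ∣_∣ eq) ∣e∣))))

    ≢eʳ : ∀ {u v} → v ≢ e → u ⊕ v ≢ e
    ≢eʳ {u} {v} v≢e eq =
      v≢e (∣t∣≡0⇒t≡e (m+n≡0⇒n≡0 ∣ u ∣ (trans (sym (∣⊕∣ u v)) (trans (cong ∣_∣ eq) ∣e∣))))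

  -- The defining equations of ⊖ are e⊖, Λ⊖ and ⊕⊖.

  e⊖ : ∀ v → e ⊖ v ≡ v
  e⊖ v = mul-irr (view e) (v-e refl) v refl

  Λ⊖ : ∀ u v → Λ u ⊖ v ≡ Λ (u ⊖ v)
  Λ⊖ u v = mul-irr (view (Λ u)) (v-Λ u refl (view u)) v refl

  private
    Λ⊕⊖ : ∀ s {w} v → w ≢ e → (Λ s ⊕ w) ⊖ v ≡ Λ s ⊕ (w ⊖ v)
    Λ⊕⊖ s {w} v w≢e =
      mul-irr (view (Λ s ⊕ w)) (v-⊕ s w w≢e refl (view s) (view w)) v refl

  ⊕⊖ : ∀ t u v → t ≢ e → u ≢ e → (t ⊕ u) ⊖ v ≡ t ⊕ (u ⊖ v)
  ⊕⊖ t u v t≢e u≢e = induction P (λ e≢e → ⊥-elim (e≢e refl)) pΛ p⊕ t t≢e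
    where
    P : C → Set
    P t = t ≢ e → (t ⊕ u) ⊖ v ≡ t ⊕ (u ⊖ v)
    pΛ : ∀ s → P s → P (Λ s)
    pΛ s _ _ = Λ⊕⊖ s v u≢e
    p⊕ : ∀ s w → w ≢ e → P s → P w → P (Λ s ⊕ w)
    p⊕ s w w≢e _ ih _ = begin
      ((Λ s ⊕ w) ⊕ u) ⊖ v  ≡⟨ cong (_⊖ v) (⊕-assoc (Λ s) w u) ⟩
      (Λ s ⊕ w ⊕ u) ⊖ v    ≡⟨ Λ⊕⊖ s v (≢eˡ w≢e) ⟩
      Λ s ⊕ ((w ⊕ u) ⊖ v)  ≡⟨ cong (Λ s ⊕_) (ih w≢e) ⟩
      Λ s ⊕ (w ⊕ (u ⊖ v))  ≡⟨ ⊕-assoc (Λ s) w (u ⊖ v) ⟨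
      (Λ s ⊕ w) ⊕ (u ⊖ v)  ∎
      where open ≡-Reasoning

  private
    ∣γ∣ : ∀ t → ∣ γ t ∣ ≡ suc ∣ t ∣
    ∣γ∣ t rewrite ∣⊕∣ t (Λ e) | ∣Λ∣ e | ∣e∣ | +-suc ∣ t ∣ 0 | +-identityʳ ∣ t ∣ = refl

    ∣⊖∣ : ∀ u v → ∣ u ⊖ v ∣ ≡ ∣ u ∣ + ∣ v ∣
    ∣⊖∣ u v = induction P pe pΛ p⊕ u
      where
      P : C → Set
      P u = ∣ u ⊖ v ∣ ≡ ∣ u ∣ + ∣ v ∣
      pe : P e
      pe rewrite e⊖ v | ∣e∣ = refl
      pΛ : ∀ s → P s → P (Λ s)
      pΛ s ih rewrite Λ⊖ s v | ∣Λ∣ (s ⊖ v) | ∣Λ∣ s = cong suc ih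
      p⊕ : ∀ s w → w ≢ e → P s → P w → P (Λ s ⊕ w)
      p⊕ s w w≢e _ ih rewrite Λ⊕⊖ s v w≢e | ∣⊕∣ (Λ s) (w ⊖ v) | ∣⊕∣ (Λ s) w | ih =
        sym (+-assoc (∣ Λ s ∣) (∣ w ∣) (∣ v ∣))

    ⊖≢eˡ : ∀ {u v} → u ≢ e → u ⊖ v ≢ e
    ⊖≢eˡ {u} {v} u≢e eq =
      u≢e (∣t∣≡0⇒t≡e (m+n≡0⇒m≡0 ∣ u ∣ (trans (sym (∣⊖∣ u v)) (trans (cong ∣_∣ eq) ∣e∣))))

    ⊖≢eʳ : ∀ {u v} → v ≢ e → u ⊖ v ≢ e
    ⊖≢eʳ {u} {v} v≢e eq =
      v≢e (∣t∣≡0⇒t≡e (m+n≡0⇒n≡0 ∣ u ∣ (trans (sym (∣⊖∣ u v)) (trans (cong ∣_∣ eq) ∣e∣))))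

    ⊖-identityʳ : ∀ t → t ⊖ e ≡ t
    ⊖-identityʳ = induction (λ t → t ⊖ e ≡ t) (e⊖ e)
      (λ s ih → trans (Λ⊖ s e) (cong Λ ih))
      (λ s w w≢e _ ih → trans (Λ⊕⊖ s e w≢e) (cong (Λ s ⊕_) ih))

    ⊖-assoc : ∀ t u v → (t ⊖ u) ⊖ v ≡ t ⊖ (u ⊖ v)
    ⊖-assoc t u v = induction P
      (trans (cong (_⊖ v) (e⊖ u)) (sym (e⊖ (u ⊖ v)))) pΛ p⊕ t
      where
      open ≡-Reasoning
      P : C → Set
      P t = (t ⊖ u) ⊖ v ≡ t ⊖ (u ⊖ v)
      pΛ : ∀ s → P s → P (Λ s)
      pΛ s ih = begin
        (Λ s ⊖ u) ⊖ v    ≡⟨ cong (_⊖ v) (Λ⊖ s u) ⟩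
        Λ (s ⊖ u) ⊖ v    ≡⟨ Λ⊖ (s ⊖ u) v ⟩
        Λ ((s ⊖ u) ⊖ v)  ≡⟨ cong Λ ih ⟩
        Λ (s ⊖ (u ⊖ v))  ≡⟨ Λ⊖ s (u ⊖ v) ⟨
        Λ s ⊖ (u ⊖ v)    ∎
      p⊕ : ∀ s w → w ≢ e → P s → P w → P (Λ s ⊕ w)
      p⊕ s w w≢e _ ih = begin
        ((Λ s ⊕ w) ⊖ u) ⊖ v  ≡⟨ cong (_⊖ v) (Λ⊕⊖ s u w≢e) ⟩
        (Λ s ⊕ (w ⊖ u)) ⊖ v  ≡⟨ Λ⊕⊖ s v (⊖≢eˡ w≢e) ⟩
        Λ s ⊕ ((w ⊖ u) ⊖ v)  ≡⟨ cong (Λ s ⊕_) ih ⟩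
        Λ s ⊕ (w ⊖ (u ⊖ v))  ≡⟨ Λ⊕⊖ s (u ⊖ v) w≢e ⟨
        (Λ s ⊕ w) ⊖ (u ⊖ v)  ∎

    isEmpty : ∀ t → t ≡ e ⊎ t ≢ e
    isEmpty t with form t
    ... | empty eq = inj₁ eq
    ... | indec (_ , refl) = inj₂ Λ≢e
    ... | decomp _ _ p q refl = inj₂ (⊕≢e p q)

    cons-cases : (P : C → Set) → P e → (∀ s w → P w → P (Λ s ⊕ w)) → ∀ t → P t
    cons-cases P pe p⊕ = induction P pe
      (λ s _ → subst P (⊕-identityʳ (Λ s)) (p⊕ s e pe)) (λ s w _ _ → p⊕ s w)

    cons-inj : ∀ {a b} w w′ → Λ a ⊕ w ≡ Λ b ⊕ w′ → a ≡ b × w ≡ w′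
    cons-inj {a} {b} w w′ eq with isEmpty w | isEmpty w′
    ... | inj₁ refl | inj₁ refl =
          Λ-injective (trans (sym (⊕-identityʳ _)) (trans eq (⊕-identityʳ _))) , refl
    ... | inj₁ refl | inj₂ w′≢e =
          ⊥-elim (Λ≢⊕ (b , refl) w′≢e (trans (sym (⊕-identityʳ _)) eq))
    ... | inj₂ w≢e | inj₁ refl =
          ⊥-elim (Λ≢⊕ (a , refl) w≢e (trans (sym (⊕-identityʳ _)) (sym eq)))
    ... | inj₂ w≢e | inj₂ w′≢e with ⊕-unique (a , refl) w≢e (b , refl) w′≢e eq
    ...   | Λa≡Λb , w≡w′ = Λ-injective Λa≡Λb , w≡w′

    snoc-inj : ∀ s s′ {v v′} → s ⊕ Λ v ≡ s′ ⊕ Λ v′ → s ≡ s′ × v ≡ v′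
    snoc-inj s s′ {v} {v′} = cons-cases P (cons-cases Q qe q⊕)
      (λ a w ih → cons-cases (R a w) (re a w) (λ b w′ _ → r⊕ a w ih b w′)) s s′
      where
      R : C → C → C → Set
      R a w s′ = (Λ a ⊕ w) ⊕ Λ v ≡ s′ ⊕ Λ v′ → Λ a ⊕ w ≡ s′ × v ≡ v′
      Q : C → Set
      Q s′ = e ⊕ Λ v ≡ s′ ⊕ Λ v′ → e ≡ s′ × v ≡ v′
      P : C → Set
      P s = ∀ s′ → s ⊕ Λ v ≡ s′ ⊕ Λ v′ → s ≡ s′ × v ≡ v′
      short≢long : ∀ {x y b w} → e ⊕ Λ x ≢ (Λ b ⊕ w) ⊕ Λ y
      short≢long {x} {y} {b} {w} eq =
        ≢eʳ {w} {Λ y} Λ≢e (sym (proj₂ (cons-inj e (w ⊕ Λ y)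
          (trans (⊕-identityʳ _) (trans (sym (⊕-identityˡ _))
            (trans eq (⊕-assoc _ _ _)))))))
      qe : Q e
      qe eq = refl , Λ-injective (trans (sym (⊕-identityˡ _)) (trans eq (⊕-identityˡ _)))
      q⊕ : ∀ b w → Q w → Q (Λ b ⊕ w)
      q⊕ b w _ eq = ⊥-elim (short≢long eq)
      re : ∀ a w → R a w e
      re a w eq = ⊥-elim (short≢long (sym eq))
      r⊕ : ∀ a w → P w → ∀ b w′ → R a w (Λ b ⊕ w′)
      r⊕ a w ih b w′ eq
        with cons-inj (w ⊕ Λ v) (w′ ⊕ Λ v′)
               (trans (sym (⊕-assoc _ _ _)) (trans eq (⊕-assoc _ _ _)))
      ... | refl , eq′ with ih w′ eq′
      ...   | refl , v≡v′ = refl , v≡v′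

    γ⊖ : ∀ s v → γ s ⊖ v ≡ s ⊕ Λ v
    γ⊖ s v with isEmpty s
    ... | inj₁ refl = begin
          (e ⊕ Λ e) ⊖ v  ≡⟨ cong (_⊖ v) (⊕-identityˡ (Λ e)) ⟩
          Λ e ⊖ v        ≡⟨ Λ⊖ e v ⟩
          Λ (e ⊖ v)      ≡⟨ cong Λ (e⊖ v) ⟩
          Λ v            ≡⟨ ⊕-identityˡ (Λ v) ⟨
          e ⊕ Λ v        ∎
          where open ≡-Reasoning
    ... | inj₂ s≢e = begin
          (s ⊕ Λ e) ⊖ v  ≡⟨ ⊕⊖ s (Λ e) v s≢e Λ≢e ⟩
          s ⊕ (Λ e ⊖ v)  ≡⟨ cong (s ⊕_) (trans (Λ⊖ e v) (cong Λ (e⊖ v))) ⟩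
          s ⊕ Λ v        ∎
          where open ≡-Reasoning

    snoc : ∀ t → t ≡ e ⊎ (∃[ s ] ∃[ v ] t ≡ s ⊕ Λ v)
    snoc = induction (λ t → t ≡ e ⊎ (∃[ s ] ∃[ v ] t ≡ s ⊕ Λ v)) (inj₁ refl)
      (λ s _ → inj₂ (e , s , sym (⊕-identityˡ (Λ s)))) step
      where
      step : ∀ s w → w ≢ e → _ → w ≡ e ⊎ (∃[ s′ ] ∃[ v ] w ≡ s′ ⊕ Λ v) →
             Λ s ⊕ w ≡ e ⊎ (∃[ s′ ] ∃[ v ] Λ s ⊕ w ≡ s′ ⊕ Λ v)
      step s w w≢e _ (inj₁ eq) = ⊥-elim (w≢e eq)
      step s w w≢e _ (inj₂ (s′ , v , refl)) =
        inj₂ (Λ s ⊕ s′ , v , sym (⊕-assoc (Λ s) s′ (Λ v)))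

    form′ : ∀ t → Form e γ _⊖_ t
    form′ t with snoc t
    ... | inj₁ eq = empty eq
    ... | inj₂ (s , v , eq) with isEmpty v
    ...   | inj₁ refl = indec (s , eq)
    ...   | inj₂ v≢e  = decomp (γ s) v (s , refl) v≢e (trans eq (sym (γ⊖ s v)))

  isCatalan′ : IsCatalan ∣_∣ e γ _⊖_
  isCatalan′ = record
    { ∣e∣         = ∣e∣
    ; ∣t∣≡0⇒t≡e   = ∣t∣≡0⇒t≡e
    ; ∣Λ∣         = ∣γ∣
    ; ∣⊕∣         = ∣⊖∣
    ; ⊕-isMonoid  = record
      { isSemigroup = record
        { isMagma = record { isEquivalence = isEquivalence ; ∙-cong = cong₂ _⊖_ }
        ; assoc   = ⊖-assoc }
      ; identity    = e⊖ , ⊖-identityʳ }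
    ; form        = form′
    ; Λ≢e         = ≢eʳ Λ≢e
    ; ⊕≢e         = λ _ v≢e → ⊖≢eʳ v≢e
    ; Λ≢⊕         = λ { (u , refl) v≢e eq →
                        v≢e (sym (proj₂ (snoc-inj _ u (trans eq (γ⊖ u _))))) }
    ; Λ-injective = λ {s} {t} eq → proj₁ (snoc-inj s t eq)
    ; ⊕-unique    = λ { (s , refl) _ (s′ , refl) _ eq →
                        let s≡s′ , v≡v′ = snoc-inj s s′ (trans (sym (γ⊖ s _)) (trans eq (γ⊖ s′ _)))
                        in cong γ s≡s′ , v≡v′ }
    }

  secondary : Catalan ∣_∣ e
  secondary = record { Λ = γ ; _⊕_ = _⊖_ ; isCatalan = isCatalan′ }

open Secondary using (secondary)

-- The free Catalan structure: rooted plane trees, given by their lists of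
-- children and graded by the number of edges.

data Tree : Set where
  node : List Tree → Tree

ε : Tree
ε = node []

edges : Tree → ℕ
edges (node [])       = 0
edges (node (t ∷ ts)) = suc (edges t) + edges (node ts)

free : Catalan edges ε
free = record
  { Λ         = Λ
  ; _⊕_       = _⊕_
  ; isCatalan = record
    { ∣e∣         = refl
    ; ∣t∣≡0⇒t≡e   = λ { {node []} _ → refl }
    ; ∣Λ∣         = λ t → cong suc (+-identityʳ (edges t))
    ; ∣⊕∣         = λ { (node us) (node vs) → edges-++ us vs }
    ; ⊕-isMonoid  = record
      { isSemigroup = record
        { isMagma = record { isEquivalence = isEquivalence ; ∙-cong = cong₂ _⊕_ }
        ; assoc   = λ { (node ts) (node us) (node vs) → cong node (++-assoc ts us vs) } }
      ; identity    = (λ { (node _) → refl })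
                    , (λ { (node ts) → cong node (++-identityʳ ts) }) }
    ; form        = form
    ; Λ≢e         = λ ()
    ; ⊕≢e         = λ { {v = node _} (_ , refl) _ () }
    ; Λ≢⊕         = λ { {v = node []} (_ , refl) v≢e _ → v≢e refl
                      ; {v = node (_ ∷ _)} (_ , refl) _ () }
    ; Λ-injective = λ { refl → refl }
    ; ⊕-unique    = λ { {v = node _} {v′ = node _} (_ , refl) _ (_ , refl) _ refl →
                        refl , refl }
    }
  }
  where
  Λ : Tree → Tree
  Λ t = node [ t ]

  _⊕_ : Tree → Tree → Tree
  node us ⊕ node vs = node (us ++ vs)

  edges-++ : ∀ us vs → edges (node (us ++ vs)) ≡ edges (node us) + edges (node vs)
  edges-++ []       vs = refl
  edges-++ (u ∷ us) vs = cong suc (trans (cong (edges u +_) (edges-++ us vs))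
                                         (sym (+-assoc (edges u) _ _)))

  form : ∀ t → Form ε Λ _⊕_ t
  form (node [])           = empty refl
  form (node (t ∷ []))     = indec (t , refl)
  form (node (t ∷ u ∷ us)) = decomp (Λ t) (node (u ∷ us)) (t , refl) (λ ()) refl

-- structure i is (λᵢ , ⊕ᵢ), for i ≥ 1.

structure : (i : ℕ) → .{{NonZero i}} → Catalan edges ε
structure (suc k) = fold free secondary k

open Catalan (structure 1) public using (Λ; _⊕_)
open Catalan (structure 2) public using () renaming (Λ to γ; _⊕_ to _⊖_)

-- node (u ∷ v) is Λ u ⊕ node v.

h : Tree → Tree
h (node [])      = ε
h (node (u ∷ v)) = h (node v) ⊖ γ (h u)

rev : Tree → Tree
rev (node [])      = ε
rev (node (u ∷ v)) = rev (node v) ⊕ Λ (rev u)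

M : Tree → Tree
M = h ∘ rev

{-# OPTIONS --safe #-}

-- Since rev reverses ⊕ and h turns ⊕ into the reversal of ⊖, the composite
-- M = h ∘ rev is a homomorphism from (λ₁,⊕₁) to (λ₂,⊕₂).  The secondary
-- construction is functorial, so M maps each (λᵢ,⊕ᵢ) to (λᵢ₊₁,⊕ᵢ₊₁), and Mᵖ is a
-- homomorphism from (λ₁,⊕₁) to (λₚ₊₁,⊕ₚ₊₁).  If Mᵖ = id, the two pairs of
-- operations agree; if they agree, Mᵖ is an endomorphism of a structure
-- generated by e, λ and ⊕, hence the identity.

module Submission where

open import Algebra.Structures using (IsMonoid)
open import Data.Empty using (⊥-elim)
open import Data.List.Base using ([]; _∷_)
open import Data.Nat.Base using (ℕ; zero; suc)
open import Data.Nat.GeneralisedArithmetic using (fold)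
open import Data.Product.Base using (_,_)
open import Function.Base using (_∘_)
open import Function.Bundles using (_⇔_; mk⇔)
open import Relation.Binary.PropositionalEquality
  using (_≡_; _≢_; refl; sym; trans; cong; cong₂; module ≡-Reasoning)
open import Defs

open Secondary using (secondary)

record IsHom {C D : Set} {∣_∣ : C → ℕ} {∥_∥ : D → ℕ} {e : C} {e′ : D}
             (S : Catalan ∣_∣ e) (T : Catalan ∥_∥ e′) (f : C → D) : Set where
  private
    module S = Catalan S
    module T = Catalan T
  field
    e-homo : f e ≡ e′
    Λ-homo : ∀ t → f (S.Λ t) ≡ T.Λ (f t)
    ⊕-homo : ∀ u v → f (u S.⊕ v) ≡ f u T.⊕ f v

module _ {C D : Set} {∣_∣ : C → ℕ} {∥_∥ : D → ℕ} {e : C} {e′ : D}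
         {S : Catalan ∣_∣ e} {T : Catalan ∥_∥ e′} {f : C → D} (F : IsHom S T f) where
  private
    module S where
      open Catalan S public
      open Secondary S public
    module T where
      open Catalan T public
      open Secondary T public
  open IsHom F
  open ≡-Reasoning

  -- Supplies the side conditions of `T.⊕⊖`. By `Λ-homo`, `f` keeps indecomposables indecomposable,
  -- so the form of `t` carries over to `f t`, and the forms in `T` exclude each other.
  hom-≢e : ∀ t → t ≢ e → f t ≢ e′
  hom-≢e = S.induction (λ t → t ≢ e → f t ≢ e′) (λ e≢e → ⊥-elim (e≢e refl))
    (λ s _ _ eq → T.Λ≢e (trans (sym (Λ-homo s)) eq))
    (λ s w w≢e _ ih _ eq →
      T.⊕≢e (f s , Λ-homo s) (ih w≢e) (trans (sym (⊕-homo (S.Λ s) w)) eq))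

  -- The three defining equations of `⊖` involve only `e`, `Λ` and `⊕`, all respected by `f`; each
  -- case applies one of them in `S` and undoes it in `T`.
  ⊖-homo : ∀ u v → f (u S.⊖ v) ≡ f u T.⊖ f v
  ⊖-homo u v = S.induction (λ u → f (u S.⊖ v) ≡ f u T.⊖ f v) base step-Λ step-⊕ u
    where
    base : f (e S.⊖ v) ≡ f e T.⊖ f v
    base = begin
      f (e S.⊖ v)    ≡⟨ cong f (S.e⊖ v) ⟩
      f v            ≡⟨ T.e⊖ (f v) ⟨
      e′ T.⊖ f v     ≡⟨ cong (T._⊖ f v) e-homo ⟨
      f e T.⊖ f v    ∎

    step-Λ : ∀ s → f (s S.⊖ v) ≡ f s T.⊖ f v → f (S.Λ s S.⊖ v) ≡ f (S.Λ s) T.⊖ f v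
    step-Λ s ih = begin
      f (S.Λ s S.⊖ v)      ≡⟨ cong f (S.Λ⊖ s v) ⟩
      f (S.Λ (s S.⊖ v))    ≡⟨ Λ-homo (s S.⊖ v) ⟩
      T.Λ (f (s S.⊖ v))    ≡⟨ cong T.Λ ih ⟩
      T.Λ (f s T.⊖ f v)    ≡⟨ T.Λ⊖ (f s) (f v) ⟨
      T.Λ (f s) T.⊖ f v    ≡⟨ cong (T._⊖ f v) (Λ-homo s) ⟨
      f (S.Λ s) T.⊖ f v    ∎

    step-⊕ : ∀ s w → w ≢ e → f (s S.⊖ v) ≡ f s T.⊖ f v → f (w S.⊖ v) ≡ f w T.⊖ f v →
             f ((S.Λ s S.⊕ w) S.⊖ v) ≡ f (S.Λ s S.⊕ w) T.⊖ f v
    step-⊕ s w w≢e _ ih = begin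
      f ((S.Λ s S.⊕ w) S.⊖ v)        ≡⟨ cong f (S.⊕⊖ (S.Λ s) w v S.Λ≢e w≢e) ⟩
      f (S.Λ s S.⊕ (w S.⊖ v))        ≡⟨ ⊕-homo (S.Λ s) (w S.⊖ v) ⟩
      f (S.Λ s) T.⊕ f (w S.⊖ v)      ≡⟨ cong (f (S.Λ s) T.⊕_) ih ⟩
      f (S.Λ s) T.⊕ (f w T.⊖ f v)    ≡⟨ T.⊕⊖ (f (S.Λ s)) (f w) (f v)
                                          (hom-≢e (S.Λ s) S.Λ≢e) (hom-≢e w w≢e) ⟨
      (f (S.Λ s) T.⊕ f w) T.⊖ f v    ≡⟨ cong (T._⊖ f v) (⊕-homo (S.Λ s) w) ⟨
      f (S.Λ s S.⊕ w) T.⊖ f v        ∎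

  secondary-hom : IsHom (secondary S) (secondary T) f
  secondary-hom = record
    { e-homo = e-homo
    ; Λ-homo = λ t → begin
        f (t S.⊕ S.Λ e)      ≡⟨ ⊕-homo t (S.Λ e) ⟩
        f t T.⊕ f (S.Λ e)    ≡⟨ cong (f t T.⊕_) (Λ-homo e) ⟩
        f t T.⊕ T.Λ (f e)    ≡⟨ cong (λ x → f t T.⊕ T.Λ x) e-homo ⟩
        f t T.⊕ T.Λ e′       ∎
    ; ⊕-homo = ⊖-homo
    }

id-hom : {C : Set} {∣_∣ : C → ℕ} {e : C} {S : Catalan ∣_∣ e} → IsHom S S (λ t → t)
id-hom = record { e-homo = refl ; Λ-homo = λ _ → refl ; ⊕-homo = λ _ _ → refl }

∘-hom : {A B C : Set} {∣_∣ᵃ : A → ℕ} {∣_∣ᵇ : B → ℕ} {∣_∣ᶜ : C → ℕ} {a : A} {b : B} {c : C}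
        {R : Catalan ∣_∣ᵃ a} {S : Catalan ∣_∣ᵇ b} {T : Catalan ∣_∣ᶜ c}
        {f : A → B} {g : B → C} → IsHom S T g → IsHom R S f → IsHom R T (g ∘ f)
∘-hom {g = g} G F = record
  { e-homo = trans (cong g F.e-homo) G.e-homo
  ; Λ-homo = λ t → trans (cong g (F.Λ-homo t)) (G.Λ-homo _)
  ; ⊕-homo = λ u v → trans (cong g (F.⊕-homo u v)) (G.⊕-homo _ _)
  }
  where
  module F = IsHom F
  module G = IsHom G

module _ {C : Set} {∣_∣ : C → ℕ} {e : C} {S T : Catalan ∣_∣ e} {f : C → C}
         (F : IsHom S T f) where
  private
    module S = Catalan S
    module T = Catalan T
  open IsHom F

  hom-≈⇒id : T ≈ S → ∀ t → f t ≡ t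
  hom-≈⇒id (Λ≈ , ⊕≈) = Secondary.induction S (λ t → f t ≡ t) e-homo step-Λ
    -- The left factor is `S.Λ s`, not `s`, so `ihs` first passes through `step-Λ`.
    (λ s w _ ihs ihw →
      trans (⊕-homo (S.Λ s) w) (trans (⊕≈ _ _) (cong₂ S._⊕_ (step-Λ s ihs) ihw)))
    where
    step-Λ : ∀ s → f s ≡ s → f (S.Λ s) ≡ S.Λ s
    step-Λ s ih = trans (Λ-homo s) (trans (Λ≈ (f s)) (cong S.Λ ih))

  hom-id⇒≈ : (∀ t → f t ≡ t) → T ≈ S
  hom-id⇒≈ f≗id =
    (λ t → trans (cong T.Λ (sym (f≗id t))) (trans (sym (Λ-homo t)) (f≗id _))) ,
    (λ u v → trans (cong₂ T._⊕_ (sym (f≗id u)) (sym (f≗id v)))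
                   (trans (sym (⊕-homo u v)) (f≗id _)))

private
  module ⊕ = IsMonoid (Catalan.⊕-isMonoid (structure 1))
  module ⊖ = IsMonoid (Catalan.⊕-isMonoid (structure 2))

rev-⊕ : ∀ u v → rev (u ⊕ v) ≡ rev v ⊕ rev u
rev-⊕ (node [])       (node vs) = sym (⊕.identityʳ (rev (node vs)))
rev-⊕ (node (u ∷ us)) (node vs) =
  trans (cong (_⊕ Λ (rev u)) (rev-⊕ (node us) (node vs)))
        (⊕.assoc (rev (node vs)) (rev (node us)) (Λ (rev u)))

-- `h` sends the first child to the last `⊖`-factor, so associativity of `⊖` is all that the
-- induction along the first child list needs.
h-⊕ : ∀ u v → h (u ⊕ v) ≡ h v ⊖ h u
h-⊕ (node [])       (node vs) = sym (⊖.identityʳ (h (node vs)))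
h-⊕ (node (u ∷ us)) (node vs) =
  trans (cong (_⊖ γ (h u)) (h-⊕ (node us) (node vs)))
        (⊖.assoc (h (node vs)) (h (node us)) (γ (h u)))

M-hom : IsHom (structure 1) (structure 2) M
M-hom = record
  { e-homo = refl
  -- `M (Λ t)` unfolds to `ε ⊖ γ (M t)`.
  ; Λ-homo = λ t → ⊖.identityˡ (γ (M t))
  -- The two reversals of order cancel.
  ; ⊕-homo = λ u v → trans (cong h (rev-⊕ u v)) (h-⊕ (rev v) (rev u))
  }

M-hom-structure : ∀ p → IsHom (structure (suc p)) (structure (suc (suc p))) M
M-hom-structure zero    = M-hom
-- Both structures unfold to `secondary` of their predecessors, while the map `M` stays the same.
M-hom-structure (suc p) = secondary-hom (M-hom-structure p)

M^-hom : ∀ p → IsHom (structure 1) (structure (suc p)) (λ t → fold t M p)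
M^-hom zero    = id-hom
-- `fold` applies the new `M` outermost, so it acts between levels `suc p` and `suc (suc p)`.
M^-hom (suc p) = ∘-hom (M-hom-structure p) (M^-hom p)

theorem5p13 : (p : ℕ) →
    (structure (suc p) ≈ structure 1) ⇔ ((t : Tree) → fold t M p ≡ t)
theorem5p13 p = mk⇔ (hom-≈⇒id (M^-hom p)) (hom-id⇒≈ (M^-hom p))
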